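{- Let $\lambda\in\mathbb{R}$, let $r,n\ge0$ be integers and let $z\in\mathbb{C}$. Then \[ \phi_{n+1,\lambda}^{(r)}(|z|^2)=\sum_{k=0}^{n}\binom{n}{k}(-\lambda)^{n-k}(n-k)!\Big(|z|^2\phi_{k,\lambda}^{(r+1)}(|z|^2)+r\,\phi_{k,\lambda}^{(r)}(|z|^2)\Big) =\sum_{k=0}^{n}\binom{n}{k}\big(r(-\lambda)_{k,\lambda}+|z|^2(1-\lambda)_{k,\lambda}\big)\phi_{n-k,\lambda}^{(r)}(|z|^2). \] In particular, for $|z|=1$, \[ \phi_{n+1,\lambda}^{(r)}=\sum_{k=0}^{n}\binom{n}{k}(-\lambda)^{n-k}(n-k)!\Big(\phi_{k,\lambda}^{(r+1)}+r\,\phi_{k,\lambda}^{(r)}\Big)=\sum_{k=0}^{n}\binom{n}{k}\big(r(-\lambda)_{k,\lambda}+(1-\lambda)_{k,\lambda}\big)\phi_{n-k,\lambda}^{(r)}. \]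
   Context: Notation: $(x)_0=1$, $(x)_m=x(x-1)\cdots(x-m+1)$; $(y)_{0,\lambda}=1$, $(y)_{n,\lambda}=y(y-\lambda)\cdots(y-(n-1)\lambda)$. The degenerate $r$-Stirling numbers of the second kind ${n+r\brace k+r}_{r,\lambda}$ are defined by $(x+r)_{n,\lambda}=\sum_{k=0}^{n}{n+r\brace k+r}_{r,\lambda}(x)_k$ ($n\ge0$), and the degenerate $r$-Bell polynomials are $\phi_{n,\lambda}^{(r)}(x)=\sum_{k=0}^{n}{n+r\brace k+r}_{r,\lambda}x^k$, with $\phi_{n,\lambda}^{(r)}=\phi_{n,\lambda}^{(r)}(1)$. -}

module Defs where

open import Algebra.Bundles using (CommutativeRing)
open import Data.Fin.Base using (toℕ)
open import Data.Fin.Properties using (toℕ-inject₁; toℕ-fromℕ)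
open import Data.Nat.Base as ℕ using (ℕ; zero; suc; z≤n; s≤s)
import Data.Nat.Properties as ℕ
open import Data.Product.Base using (∃; _×_; _,_)
open import Data.Rational.Base as ℚ using (ℚ; 0ℚ; 1ℚ; ½; ∣_∣)
import Data.Rational.Properties as ℚ
open import Data.Rational.Solver using (module +-*-Solver)
open import Level using (0ℓ)
open import Relation.Binary.PropositionalEquality as ≡ using (_≡_)

------------------------------------------------------------------------
-- The real numbers: Cauchy sequences of rationals, up to ≈

record ℝ : Set where
  no-eta-equality
  field
    seq    : ℕ → ℚ
    cauchy : ∀ ε → 0ℚ ℚ.< ε →
             ∃ λ N → ∀ m n → N ℕ.≤ m → N ℕ.≤ n → ∣ seq m ℚ.- seq n ∣ ℚ.< ε

open ℝ public

infix 4 _≈_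

record _≈_ (x y : ℝ) : Set where
  no-eta-equality
  pattern
  constructor mk≈
  field
    null : ∀ ε → 0ℚ ℚ.< ε →
           ∃ λ N → ∀ n → N ℕ.≤ n → ∣ seq x n ℚ.- seq y n ∣ ℚ.< ε

open _≈_ public

private
  module Rational where
    open +-*-Solver

    abstract
      scale-pos : ∀ p {q} → ℚ.Positive p → 0ℚ ℚ.< q → 0ℚ ℚ.< p ℚ.* q
      scale-pos p {q} p⁺ 0<q =
        ≡.subst (ℚ._< p ℚ.* q) (ℚ.*-zeroʳ p) (ℚ.*-monoʳ-<-pos p {{p⁺}} 0<q)

      half : ℚ → ℚ
      half ε = ½ ℚ.* ε

      half-pos : ∀ {ε} → 0ℚ ℚ.< ε → 0ℚ ℚ.< half ε
      half-pos = scale-pos ½ _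

      half+half : ∀ ε → half ε ℚ.+ half ε ≡ ε
      half+half ε = ≡.trans (≡.sym (ℚ.*-distribʳ-+ ε ½ ½)) (ℚ.*-identityˡ ε)

      sum<ε : ∀ {p q ε} → p ℚ.< half ε → q ℚ.< half ε → p ℚ.+ q ℚ.< ε
      sum<ε {p} {q} {ε} p< q< = ≡.subst (p ℚ.+ q ℚ.<_) (half+half ε) (ℚ.+-mono-< p< q<)

      diff-self : ∀ {p q ε} → p ≡ q → 0ℚ ℚ.< ε → ∣ p ℚ.- q ∣ ℚ.< ε
      diff-self {p} {ε = ε} ≡.refl 0<ε =
        ≡.subst (λ t → ∣ t ∣ ℚ.< ε) (≡.sym (ℚ.+-inverseʳ p)) 0<ε

      diff-sym : ∀ p q → ∣ p ℚ.- q ∣ ≡ ∣ q ℚ.- p ∣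
      diff-sym p q = ≡.trans (≡.sym (ℚ.∣-p∣≡∣p∣ (p ℚ.- q)))
        (≡.cong ∣_∣ (solve 2 (λ a b → :- (a :- b) := b :- a) ≡.refl p q))

      diff-trans : ∀ {p q r ε} → ∣ p ℚ.- q ∣ ℚ.< half ε → ∣ q ℚ.- r ∣ ℚ.< half ε →
                   ∣ p ℚ.- r ∣ ℚ.< ε
      diff-trans {p} {q} {r} {ε} h₁ h₂ =
        ≡.subst (λ t → ∣ t ∣ ℚ.< ε)
          (solve 3 (λ a b c → (a :- b) :+ (b :- c) := a :- c) ≡.refl p q r)
          (ℚ.≤-<-trans (ℚ.∣p+q∣≤∣p∣+∣q∣ (p ℚ.- q) (q ℚ.- r)) (sum<ε h₁ h₂))

      diff-+ : ∀ {p q r s ε} → ∣ p ℚ.- r ∣ ℚ.< half ε → ∣ q ℚ.- s ∣ ℚ.< half ε →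
               ∣ (p ℚ.+ q) ℚ.- (r ℚ.+ s) ∣ ℚ.< ε
      diff-+ {p} {q} {r} {s} {ε} h₁ h₂ =
        ≡.subst (λ t → ∣ t ∣ ℚ.< ε)
          (solve 4 (λ a b c d → (a :- c) :+ (b :- d) := (a :+ b) :- (c :+ d)) ≡.refl p q r s)
          (ℚ.≤-<-trans (ℚ.∣p+q∣≤∣p∣+∣q∣ (p ℚ.- r) (q ℚ.- s)) (sum<ε h₁ h₂))

      diff-neg : ∀ p q → ∣ (ℚ.- p) ℚ.- (ℚ.- q) ∣ ≡ ∣ p ℚ.- q ∣
      diff-neg p q = ≡.trans
        (≡.cong ∣_∣ (solve 2 (λ a b → (:- a) :- (:- b) := :- (a :- b)) ≡.refl p q))
        (ℚ.∣-p∣≡∣p∣ (p ℚ.- q))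

      divide : ∀ {B ε} → 0ℚ ℚ.< B → 0ℚ ℚ.< ε → ∃ λ δ → (0ℚ ℚ.< δ) × (B ℚ.* δ ≡ ε)
      divide {B} {ε} 0<B 0<ε = divide′ B ε (ℚ.positive 0<B) 0<ε
        where
        divide′ : ∀ B ε → ℚ.Positive B → 0ℚ ℚ.< ε → ∃ λ δ → (0ℚ ℚ.< δ) × (B ℚ.* δ ≡ ε)
        divide′ B ε B⁺ 0<ε =
            (ℚ.1/ B) {{B≢0}} ℚ.* ε
          , scale-pos ((ℚ.1/ B) {{B≢0}}) (ℚ.1/pos⇒pos B {{B⁺}}) 0<ε
          , ≡.trans (≡.sym (ℚ.*-assoc B ((ℚ.1/ B) {{B≢0}}) ε))
              (≡.trans (≡.cong (ℚ._* ε) (ℚ.*-inverseʳ B {{B≢0}})) (ℚ.*-identityˡ ε))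
          where
          B≢0 : ℚ.NonZero B
          B≢0 = ℚ.pos⇒nonZero B {{B⁺}}

      ∣*∣<ε : ∀ {B δ ε p q} → 0ℚ ℚ.< B → B ℚ.* δ ≡ ε →
              ∣ p ∣ ℚ.≤ B → ∣ q ∣ ℚ.< δ → ∣ p ℚ.* q ∣ ℚ.< ε
      ∣*∣<ε {B} {δ} {ε} {p} {q} 0<B Bδ≡ε p≤B q<δ = begin-strict
        ∣ p ℚ.* q ∣      ≡⟨ ℚ.∣p*q∣≡∣p∣*∣q∣ p q ⟩
        ∣ p ∣ ℚ.* ∣ q ∣  ≤⟨ ℚ.*-monoʳ-≤-nonNeg ∣ q ∣ {{ℚ.∣-∣-nonNeg q}} p≤B ⟩
        B ℚ.* ∣ q ∣      <⟨ ℚ.*-monoʳ-<-pos B {{ℚ.positive 0<B}} q<δ ⟩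
        B ℚ.* δ          ≡⟨ Bδ≡ε ⟩
        ε                ∎
        where open ℚ.≤-Reasoning

      diff-* : ∀ {B C δ₁ δ₂ ε} p q r s → 0ℚ ℚ.< B → 0ℚ ℚ.< C →
               B ℚ.* δ₁ ≡ half ε → C ℚ.* δ₂ ≡ half ε →
               ∣ p ∣ ℚ.≤ B → ∣ s ∣ ℚ.≤ C →
               ∣ q ℚ.- s ∣ ℚ.< δ₁ → ∣ p ℚ.- r ∣ ℚ.< δ₂ →
               ∣ (p ℚ.* q) ℚ.- (r ℚ.* s) ∣ ℚ.< ε
      diff-* {ε = ε} p q r s 0<B 0<C Bδ Cδ p≤B s≤C h₁ h₂ =
        ≡.subst (λ t → ∣ t ∣ ℚ.< ε)
          (solve 4 (λ a b c d → (a :* (b :- d)) :+ (d :* (a :- c)) := (a :* b) :- (c :* d))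
            ≡.refl p q r s)
          (ℚ.≤-<-trans (ℚ.∣p+q∣≤∣p∣+∣q∣ (p ℚ.* (q ℚ.- s)) (s ℚ.* (p ℚ.- r)))
            (sum<ε (∣*∣<ε 0<B Bδ p≤B h₁) (∣*∣<ε 0<C Cδ s≤C h₂)))

      0<1 : 0ℚ ℚ.< 1ℚ
      0<1 = ℚ.positive⁻¹ 1ℚ

      0<1+∣p∣ : ∀ p → 0ℚ ℚ.< 1ℚ ℚ.+ ∣ p ∣
      0<1+∣p∣ p = ℚ.+-mono-<-≤ 0<1 (ℚ.0≤∣p∣ p)

      near-bound : ∀ p q → ∣ p ℚ.- q ∣ ℚ.< 1ℚ → ∣ p ∣ ℚ.≤ 1ℚ ℚ.+ ∣ q ∣
      near-bound p q h =
        ≡.subst (λ t → ∣ t ∣ ℚ.≤ 1ℚ ℚ.+ ∣ q ∣)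
          (solve 2 (λ a b → (a :- b) :+ b := a) ≡.refl p q)
          (ℚ.≤-trans (ℚ.∣p+q∣≤∣p∣+∣q∣ (p ℚ.- q) q) (ℚ.+-monoˡ-≤ ∣ q ∣ (ℚ.<⇒≤ h)))

  open Rational

  EventuallyBounded : (ℕ → ℚ) → Set
  EventuallyBounded s = ∃ λ B → ∃ λ N → (0ℚ ℚ.< B) × (∀ n → N ℕ.≤ n → ∣ s n ∣ ℚ.≤ B)

  bounded : ∀ x → EventuallyBounded (seq x)
  bounded x =
    let (N , close) = cauchy x 1ℚ 0<1
    in 1ℚ ℚ.+ ∣ seq x N ∣ , N , 0<1+∣p∣ (seq x N) ,
       λ n N≤n → near-bound (seq x n) (seq x N) (close n N N≤n ℕ.≤-refl)

  module _ {M N n : ℕ} where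
    ⊔-≤ˡ : M ℕ.⊔ N ℕ.≤ n → M ℕ.≤ n
    ⊔-≤ˡ = ℕ.m⊔n≤o⇒m≤o M N
    ⊔-≤ʳ : M ℕ.⊔ N ℕ.≤ n → N ℕ.≤ n
    ⊔-≤ʳ = ℕ.m⊔n≤o⇒n≤o M N

infixl 6 _+_
infixl 7 _*_
infix  8 -_

fromℚ : ℚ → ℝ
seq    (fromℚ q) _       = q
cauchy (fromℚ q) ε 0<ε = 0 , λ _ _ _ _ → diff-self {q} ≡.refl 0<ε

0ℝ 1ℝ : ℝ
0ℝ = fromℚ 0ℚ
1ℝ = fromℚ 1ℚ

_+_ : ℝ → ℝ → ℝ
seq    (x + y) n     = seq x n ℚ.+ seq y n
cauchy (x + y) ε 0<ε with cauchy x (half ε) (half-pos 0<ε) | cauchy y (half ε) (half-pos 0<ε)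
... | M , f | N , g = M ℕ.⊔ N , λ m n hm hn →
  diff-+ {seq x m} {seq y m} {seq x n} {seq y n}
    (f m n (⊔-≤ˡ hm) (⊔-≤ˡ hn)) (g m n (⊔-≤ʳ {M} hm) (⊔-≤ʳ {M} hn))

-_ : ℝ → ℝ
seq    (- x) n     = ℚ.- seq x n
cauchy (- x) ε 0<ε with cauchy x ε 0<ε
... | N , f = N , λ m n hm hn →
  ≡.subst (ℚ._< ε) (≡.sym (diff-neg (seq x m) (seq x n))) (f m n hm hn)

_*_ : ℝ → ℝ → ℝ
seq    (x * y) n     = seq x n ℚ.* seq y n
cauchy (x * y) ε 0<ε =
  let (B , N₁ , 0<B , x≤B) = bounded x
      (C , N₂ , 0<C , y≤C) = bounded y
      (δ₁ , 0<δ₁ , Bδ) = divide 0<B (half-pos 0<ε)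
      (δ₂ , 0<δ₂ , Cδ) = divide 0<C (half-pos 0<ε)
      (N₃ , g) = cauchy y δ₁ 0<δ₁
      (N₄ , f) = cauchy x δ₂ 0<δ₂
  in (N₁ ℕ.⊔ N₂) ℕ.⊔ (N₃ ℕ.⊔ N₄) , λ m n hm hn →
     let hm₁ = ⊔-≤ˡ {N₁ ℕ.⊔ N₂} hm ; hm₂ = ⊔-≤ʳ {N₁ ℕ.⊔ N₂} hm
         hn₁ = ⊔-≤ˡ {N₁ ℕ.⊔ N₂} hn ; hn₂ = ⊔-≤ʳ {N₁ ℕ.⊔ N₂} hn
     in diff-* (seq x m) (seq y m) (seq x n) (seq y n) 0<B 0<C Bδ Cδ
          (x≤B m (⊔-≤ˡ hm₁)) (y≤C n (⊔-≤ʳ {N₁} hn₁))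
          (g m n (⊔-≤ˡ hm₂) (⊔-≤ˡ hn₂)) (f m n (⊔-≤ʳ {N₃} hm₂) (⊔-≤ʳ {N₃} hn₂))

private
  pointwise : ∀ {x y} → (∀ n → seq x n ≡ seq y n) → x ≈ y
  pointwise eq = mk≈ λ ε 0<ε → 0 , λ n _ → diff-self (eq n) 0<ε

  ≈-sym : ∀ {x y} → x ≈ y → y ≈ x
  ≈-sym {x} {y} (mk≈ f) = mk≈ λ ε 0<ε → let (N , h) = f ε 0<ε in
    N , λ n hn → ≡.subst (ℚ._< ε) (diff-sym (seq x n) (seq y n)) (h n hn)

  ≈-trans : ∀ {x y z} → x ≈ y → y ≈ z → x ≈ z
  ≈-trans {x} {y} {z} (mk≈ f) (mk≈ g) = mk≈ λ ε 0<ε →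
    let (M , h) = f (half ε) (half-pos 0<ε)
        (N , k) = g (half ε) (half-pos 0<ε)
    in M ℕ.⊔ N , λ n hn →
       diff-trans {seq x n} {seq y n} {seq z n} (h n (⊔-≤ˡ hn)) (k n (⊔-≤ʳ {M} hn))

  +-cong : ∀ {x x′ y y′} → x ≈ x′ → y ≈ y′ → x + y ≈ x′ + y′
  +-cong {x} {x′} {y} {y′} (mk≈ f) (mk≈ g) = mk≈ λ ε 0<ε →
    let (M , h) = f (half ε) (half-pos 0<ε)
        (N , k) = g (half ε) (half-pos 0<ε)
    in M ℕ.⊔ N , λ n hn →
       diff-+ {seq x n} {seq y n} {seq x′ n} {seq y′ n} (h n (⊔-≤ˡ hn)) (k n (⊔-≤ʳ {M} hn))

  -‿cong : ∀ {x x′} → x ≈ x′ → - x ≈ - x′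
  -‿cong {x} {x′} (mk≈ f) = mk≈ λ ε 0<ε → let (N , h) = f ε 0<ε in
    N , λ n hn → ≡.subst (ℚ._< ε) (≡.sym (diff-neg (seq x n) (seq x′ n))) (h n hn)

  *-cong : ∀ {x x′ y y′} → x ≈ x′ → y ≈ y′ → x * y ≈ x′ * y′
  *-cong {x} {x′} {y} {y′} (mk≈ f) (mk≈ g) = mk≈ λ ε 0<ε →
    let (B , N₁ , 0<B , x≤B)  = bounded x
        (C , N₂ , 0<C , y′≤C) = bounded y′
        (δ₁ , 0<δ₁ , Bδ) = divide 0<B (half-pos 0<ε)
        (δ₂ , 0<δ₂ , Cδ) = divide 0<C (half-pos 0<ε)
        (N₃ , k) = g δ₁ 0<δ₁
        (N₄ , h) = f δ₂ 0<δ₂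
    in (N₁ ℕ.⊔ N₂) ℕ.⊔ (N₃ ℕ.⊔ N₄) , λ n hn →
       let hn₁ = ⊔-≤ˡ {N₁ ℕ.⊔ N₂} hn ; hn₂ = ⊔-≤ʳ {N₁ ℕ.⊔ N₂} hn
       in diff-* (seq x n) (seq y n) (seq x′ n) (seq y′ n) 0<B 0<C Bδ Cδ
            (x≤B n (⊔-≤ˡ hn₁)) (y′≤C n (⊔-≤ʳ {N₁} hn₁))
            (k n (⊔-≤ˡ hn₂)) (h n (⊔-≤ʳ {N₃} hn₂))

ℝ-commutativeRing : CommutativeRing 0ℓ 0ℓ
ℝ-commutativeRing = record
  { Carrier = ℝ ; _≈_ = _≈_ ; _+_ = _+_ ; _*_ = _*_ ; -_ = -_ ; 0# = 0ℝ ; 1# = 1ℝ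
  ; isCommutativeRing = record
    { isRing = record
      { +-isAbelianGroup = record
        { isGroup = record
          { isMonoid = record
            { isSemigroup = record
              { isMagma = record
                { isEquivalence = record
                  { refl = pointwise λ _ → ≡.refl ; sym = ≈-sym ; trans = ≈-trans }
                ; ∙-cong = +-cong }
              ; assoc = λ x y z → pointwise λ n → ℚ.+-assoc (seq x n) (seq y n) (seq z n) }
            ; identity = (λ x → pointwise λ n → ℚ.+-identityˡ (seq x n))
                       , (λ x → pointwise λ n → ℚ.+-identityʳ (seq x n)) }
          ; inverse = (λ x → pointwise λ n → ℚ.+-inverseˡ (seq x n))
                    , (λ x → pointwise λ n → ℚ.+-inverseʳ (seq x n))
          ; ⁻¹-cong = -‿cong }
        ; comm = λ x y → pointwise λ n → ℚ.+-comm (seq x n) (seq y n) }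
      ; *-cong = *-cong
      ; *-assoc = λ x y z → pointwise λ n → ℚ.*-assoc (seq x n) (seq y n) (seq z n)
      ; *-identity = (λ x → pointwise λ n → ℚ.*-identityˡ (seq x n))
                   , (λ x → pointwise λ n → ℚ.*-identityʳ (seq x n))
      ; distrib = (λ x y z → pointwise λ n → ℚ.*-distribˡ-+ (seq x n) (seq y n) (seq z n))
                , (λ x y z → pointwise λ n → ℚ.*-distribʳ-+ (seq x n) (seq y n) (seq z n)) }
    ; *-comm = λ x y → pointwise λ n → ℚ.*-comm (seq x n) (seq y n) } }

private
  module R = CommutativeRing ℝ-commutativeRing

open R public using (_-_)
open import Algebra.Properties.Semiring.Exp R.semiring public using (_^_)
open import Algebra.Properties.Semiring.Sum R.semiring public
  using (sum-syntax; sum⁺-syntax)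
open import Algebra.Properties.Semiring.Mult R.semiring using () renaming (_×_ to _·_)

fromℕ′ : ℕ → ℝ
fromℕ′ n = n · 1ℝ

record ℂ : Set where
  constructor _+i_
  field
    re im : ℝ

-- The squared modulus |z|².
∣_∣² : ℂ → ℝ
∣ x +i y ∣² = x * x + y * y

------------------------------------------------------------------------
-- Degenerate r-Stirling numbers and degenerate r-Bell polynomials

-- (x)ₘ = x (x − 1) ⋯ (x − m + 1)
falling : ℝ → ℕ → ℝ
falling x zero    = 1ℝ
falling x (suc m) = falling x m * (x - fromℕ′ m)

-- (y)ₙ,λ = y (y − λ) ⋯ (y − (n − 1) λ)
degenerateFalling : ℝ → ℝ → ℕ → ℝ
degenerateFalling lam y zero    = 1ℝ
degenerateFalling lam y (suc n) = degenerateFalling lam y n * (y - fromℕ′ n * lam)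

-- S n k plays the role of {n+r brace k+r}_{r,λ}.  Only the entries with
-- k ≤ n are constrained, and only those occur in bellPolynomial.
IsDegenerateStirling : (lam : ℝ) (r : ℕ) (S : ℕ → ℕ → ℝ) → Set
IsDegenerateStirling lam r S = ∀ n x →
  degenerateFalling lam (x + fromℕ′ r) n ≈ ∑[ k ≤ n ] (S n (toℕ k) * falling x (toℕ k))

-- For S the degenerate r-Stirling numbers, this is φₙ,λ⁽ʳ⁾(x).
bellPolynomial : (S : ℕ → ℕ → ℝ) → ℕ → ℝ → ℝ
bellPolynomial S n x = ∑[ k ≤ n ] (S n (toℕ k) * x ^ toℕ k)

bellNumber : (S : ℕ → ℕ → ℝ) → ℕ → ℝ
bellNumber S n = bellPolynomial S n 1ℝ

-- Such numbers exist: they are produced by the triangular recurrence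
-- S (n+1) k = S n (k−1) + (k + r − nλ) S n k.
private
  weight : ℝ → ℕ → ℕ → ℕ → ℝ
  weight lam r n k = (fromℕ′ k + fromℕ′ r) - fromℕ′ n * lam

stirling : ℝ → ℕ → ℕ → ℕ → ℝ
stirling lam r zero    zero    = 1ℝ
stirling lam r zero    (suc k) = 0ℝ
stirling lam r (suc n) zero    = weight lam r n zero * stirling lam r n zero
stirling lam r (suc n) (suc k) =
  stirling lam r n k + weight lam r n (suc k) * stirling lam r n (suc k)

stirling-isDegenerateStirling : ∀ lam r → IsDegenerateStirling lam r (stirling lam r)
stirling-isDegenerateStirling lam r = go
  where
  open import Algebra.Properties.Semiring.Sum R.semiring
    using (*-distribʳ-sum; sum-cong-≋; ∑-distrib-+; sum-init-last)
  open import Algebra.Solver.Ring.NaturalCoefficients.Default R.commutativeSemiring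
  open import Relation.Binary.Reasoning.Setoid R.setoid

  S = stirling lam r

  vanish : ∀ n k → n ℕ.< k → S n k ≈ 0ℝ
  vanish zero    (suc k) _         = R.refl
  vanish (suc n) (suc k) (s≤s n<k) = begin
    S n k + weight lam r n (suc k) * S n (suc k)
      ≈⟨ R.+-cong (vanish n k n<k) (R.*-congˡ (vanish n (suc k) (ℕ.m<n⇒m<1+n n<k))) ⟩
    0ℝ + weight lam r n (suc k) * 0ℝ
      ≈⟨ R.trans (R.+-identityˡ _) (R.zeroʳ _) ⟩
    0ℝ ∎

  ∑-last : ∀ (g : ℕ → ℝ) n → ∑[ k ≤ suc n ] g (toℕ k) ≈ ∑[ k ≤ n ] g (toℕ k) + g (suc n)
  ∑-last g n = R.trans (sum-init-last {suc n} (λ k → g (toℕ k)))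
    (R.+-cong
      (sum-cong-≋ {suc n} (λ k → R.reflexive (≡.cong g (toℕ-inject₁ k))))
      (R.reflexive (≡.cong g (toℕ-fromℕ (suc n)))))

  go : IsDegenerateStirling lam r S
  go zero    x = R.sym (R.trans (R.+-identityʳ _) (R.*-identityˡ 1ℝ))
  go (suc n) x = begin
    degenerateFalling lam (x + fromℕ′ r) n * y
      ≈⟨ R.*-congʳ (go n x) ⟩
    (∑[ k ≤ n ] (S n (toℕ k) * f (toℕ k))) * y
      ≈⟨ *-distribʳ-sum {suc n} y (λ k → S n (toℕ k) * f (toℕ k)) ⟩
    ∑[ k ≤ n ] (S n (toℕ k) * f (toℕ k) * y)
      ≈⟨ sum-cong-≋ {suc n} (λ k → step (toℕ k)) ⟩
    ∑[ k ≤ n ] (h (toℕ k) + g (toℕ k))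
      ≈⟨ ∑-distrib-+ {suc n} (λ k → h (toℕ k)) (λ k → g (toℕ k)) ⟩
    ∑[ k ≤ n ] h (toℕ k) + ∑[ k ≤ n ] g (toℕ k)
      ≈⟨ R.+-congˡ (R.trans (R.+-congˡ g-top) (R.+-identityʳ _)) ⟨
    ∑[ k ≤ n ] h (toℕ k) + (∑[ k ≤ n ] g (toℕ k) + g (suc n))
      ≈⟨ R.+-congˡ (∑-last g n) ⟨
    ∑[ k ≤ n ] h (toℕ k) + (g 0 + ∑[ k ≤ n ] g (suc (toℕ k)))
      ≈⟨ solve 3 (λ a b c → a :+ (b :+ c) := b :+ (a :+ c)) R.refl _ _ _ ⟩
    g 0 + (∑[ k ≤ n ] h (toℕ k) + ∑[ k ≤ n ] g (suc (toℕ k)))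
      ≈⟨ R.+-congˡ (∑-distrib-+ {suc n} (λ k → h (toℕ k)) (λ k → g (suc (toℕ k)))) ⟨
    g 0 + ∑[ k ≤ n ] (h (toℕ k) + g (suc (toℕ k)))
      ≈⟨ R.+-congˡ (sum-cong-≋ {suc n} (λ k → R.distribʳ (f (suc (toℕ k))) (S n (toℕ k))
           (weight lam r n (suc (toℕ k)) * S n (suc (toℕ k))))) ⟨
    ∑[ k ≤ suc n ] (S (suc n) (toℕ k) * f (toℕ k)) ∎
    where
    y = (x + fromℕ′ r) - fromℕ′ n * lam
    f h g : ℕ → ℝ
    f = falling x
    h k = S n k * f (suc k)
    g k = weight lam r n k * S n k * f k

    g-top : g (suc n) ≈ 0ℝ
    g-top = begin
      weight lam r n (suc n) * S n (suc n) * f (suc n)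
        ≈⟨ R.*-congʳ (R.*-congˡ (vanish n (suc n) ℕ.≤-refl)) ⟩
      weight lam r n (suc n) * 0ℝ * f (suc n)
        ≈⟨ R.trans (R.*-congʳ (R.zeroʳ _)) (R.zeroˡ _) ⟩
      0ℝ ∎

    split : ∀ k → x ≈ (x - fromℕ′ k) + fromℕ′ k
    split k = R.sym (R.trans (R.+-assoc _ _ _)
      (R.trans (R.+-congˡ (R.-‿inverseˡ (fromℕ′ k))) (R.+-identityʳ x)))

    step : ∀ k → S n k * f k * y ≈ h k + g k
    step k = begin
      S n k * f k * ((x + fromℕ′ r) - fromℕ′ n * lam)
        ≈⟨ R.*-congˡ (R.+-congʳ (R.+-congʳ (split k))) ⟩
      S n k * f k * (((x - fromℕ′ k) + fromℕ′ k + fromℕ′ r) - fromℕ′ n * lam)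
        ≈⟨ solve 6 (λ s f d k r w → s :* f :* ((d :+ k :+ r) :+ w)
                      := s :* (f :* d) :+ ((k :+ r) :+ w) :* s :* f)
             R.refl (S n k) (f k) (x - fromℕ′ k) (fromℕ′ k) (fromℕ′ r) (- (fromℕ′ n * lam)) ⟩
      h k + g k ∎

{-# OPTIONS --safe #-}

-- Umbral calculus: let L be the linear functional (x)ₖ ↦ yᵏ on polynomial functions
-- (the expectation under a Poisson law of mean y).  It is well defined because a Newton
-- series vanishing at all natural numbers has zero coefficients.  By definition
-- φₙ,λ⁽ʳ⁾(y) = L (x + r)ₙ,λ, and (x)ₖ₊₁ = x (x − 1)ₖ gives L (x p(x − 1)) = y L p.
-- Now (x + r)ₙ₊₁,λ = (x + r) (x + r − λ)ₙ,λ; the factor is split into r and x, and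
-- (x + r − λ)ₙ,λ is expanded by the degenerate Vandermonde identity.  Writing its argument
-- as (x + r) + (−λ), in the form (x − 1) + (r + 1) + (−λ) next to the factor x, gives the
-- first sum; writing it as (x − 1) + r + (1 − λ) next to the factor x gives the second.
module Submission where

open import Defs
open import Algebra.Bundles using (CommutativeRing)
import Algebra.Properties.Ring as RingProperties
import Algebra.Properties.Semiring.Mult as SemiringMult
open import Algebra.Properties.Semiring.Sum
  (CommutativeRing.semiring ℝ-commutativeRing)
  using (sum; sum-cong-≋; ∑-distrib-+; *-distribˡ-sum; *-distribʳ-sum; sum-init-last)
open import Algebra.Solver.Ring.NaturalCoefficients.Default
  (CommutativeRing.commutativeSemiring ℝ-commutativeRing)
open import Data.Fin.Base using (Fin; toℕ)
open import Data.Fin.Properties using (toℕ-inject₁; toℕ-fromℕ; toℕ≤pred[n])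
open import Data.List.Base using (List; []; _∷_; map; tabulate)
open import Data.Nat.Base as ℕ using (ℕ; zero; suc; _∸_; _!)
open import Data.Nat.Combinatorics using (_C_; nCk+nC[k+1]≡[n+1]C[k+1]; k>n⇒nCk≡0)
import Data.Nat.Properties as ℕ
open import Data.Product.Base using (∃; _×_; _,_)
open import Data.Rational.Base as ℚ using (0ℚ; 1ℚ)
import Data.Rational.Properties as ℚ
open import Function.Base using (_∘_)
open import Relation.Binary.PropositionalEquality as ≡ using (_≡_)

private
  module R = CommutativeRing ℝ-commutativeRing
  module RP = RingProperties R.ring
  module RM = SemiringMult R.semiring

open import Relation.Binary.Reasoning.Setoid R.setoid

private
  variable
    x x′ y u v lam : ℝ
    φ ψ : ℝ → ℝ

-- Natural numbers as reals, and division by nonzero ones.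

fromℕ′-+ : ∀ m n → fromℕ′ (m ℕ.+ n) ≈ fromℕ′ m + fromℕ′ n
fromℕ′-+ = RM.×-homo-+ 1ℝ

fromℕ′-* : ∀ m n → fromℕ′ (m ℕ.* n) ≈ fromℕ′ m * fromℕ′ n
fromℕ′-* = RM.×1-homo-*

-- The Cauchy sequence of `fromℕ′ (suc m)` is constant with a positive rational value `q`, so the
-- constant sequence `q⁻¹` is an inverse, exact at every index.
fromℕ′-inverse : ∀ m → ∃ λ u → u * fromℕ′ (suc m) ≈ 1ℝ
fromℕ′-inverse m = fromℚ q⁻¹ , mk≈ λ ε 0<ε → 0 , λ k _ →
  ≡.subst (λ t → ℚ.∣ t ∣ ℚ.< ε)
    (≡.sym (≡.trans (≡.cong (ℚ._- 1ℚ) (q⁻¹*seq k)) (ℚ.+-inverseʳ 1ℚ))) 0<ε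
  where
  q = seq (fromℕ′ (suc m)) 0
  seq-const : ∀ m k → seq (fromℕ′ m) k ≡ seq (fromℕ′ m) 0
  seq-const zero    k = ≡.refl
  seq-const (suc m) k = ≡.cong (1ℚ ℚ.+_) (seq-const m k)
  nonNegative : ∀ m → 0ℚ ℚ.≤ seq (fromℕ′ m) 0
  nonNegative zero    = ℚ.≤-refl
  nonNegative (suc m) = ℚ.+-mono-≤ (ℚ.<⇒≤ (ℚ.positive⁻¹ 1ℚ)) (nonNegative m)
  instance
    q≢0 : ℚ.NonZero q
    q≢0 = ℚ.pos⇒nonZero q {{ℚ.positive (ℚ.+-mono-<-≤ (ℚ.positive⁻¹ 1ℚ) (nonNegative m))}}
  q⁻¹ = ℚ.1/ q
  q⁻¹*seq : ∀ k → q⁻¹ ℚ.* seq (fromℕ′ (suc m)) k ≡ 1ℚ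
  q⁻¹*seq k = ≡.trans (≡.cong (q⁻¹ ℚ.*_) (seq-const (suc m) k)) (ℚ.*-inverseˡ q)

fromℕ′-cancel : ∀ m → fromℕ′ (suc m) * x ≈ 0ℝ → x ≈ 0ℝ
fromℕ′-cancel {x} m eq with u , inv ← fromℕ′-inverse m = begin
  x                         ≈⟨ R.*-identityˡ x ⟨
  1ℝ * x                    ≈⟨ R.*-congʳ inv ⟨
  (u * fromℕ′ (suc m)) * x  ≈⟨ R.*-assoc _ _ _ ⟩
  u * (fromℕ′ (suc m) * x)  ≈⟨ R.*-congˡ eq ⟩
  u * 0ℝ                    ≈⟨ R.zeroʳ u ⟩
  0ℝ                        ∎

-- Newton series and their images under (x)ₖ ↦ yᵏ.

-- Σ aₖ (x)ₖ in nested form, using (x)ₖ₊₁ = x (x − 1)ₖ.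
newton : List ℝ → ℝ → ℝ
newton []       x = 0ℝ
newton (a ∷ as) x = a + x * newton as (x - 1ℝ)

-- Σ aₖ yᵏ, nested like `newton` but with the argument kept at `y` instead of lowered by 1, so that
-- facts about the two run in parallel.
horner : List ℝ → ℝ → ℝ
horner []       y = 0ℝ
horner (a ∷ as) y = a + y * horner as y

infixl 6 _⊕_

_⊕_ : List ℝ → List ℝ → List ℝ
[]       ⊕ bs       = bs
(a ∷ as) ⊕ []       = a ∷ as
(a ∷ as) ⊕ (b ∷ bs) = (a + b) ∷ (as ⊕ bs)

newton-⊕ : ∀ as bs x → newton (as ⊕ bs) x ≈ newton as x + newton bs x
newton-⊕ []       bs       x = R.sym (R.+-identityˡ _)
newton-⊕ (a ∷ as) []       x = R.sym (R.+-identityʳ _)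
newton-⊕ (a ∷ as) (b ∷ bs) x = R.trans
  (R.+-congˡ (R.*-congˡ (newton-⊕ as bs (x - 1ℝ))))
  (solve 5 (λ a b x p q → a :+ b :+ x :* (p :+ q) := a :+ x :* p :+ (b :+ x :* q))
    R.refl a b x _ _)

horner-⊕ : ∀ as bs y → horner (as ⊕ bs) y ≈ horner as y + horner bs y
horner-⊕ []       bs       y = R.sym (R.+-identityˡ _)
horner-⊕ (a ∷ as) []       y = R.sym (R.+-identityʳ _)
horner-⊕ (a ∷ as) (b ∷ bs) y = R.trans
  (R.+-congˡ (R.*-congˡ (horner-⊕ as bs y)))
  (solve 5 (λ a b x p q → a :+ b :+ x :* (p :+ q) := a :+ x :* p :+ (b :+ x :* q))
    R.refl a b y _ _)

newton-scale : ∀ c as x → newton (map (c *_) as) x ≈ c * newton as x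
newton-scale c []       x = R.sym (R.zeroʳ c)
newton-scale c (a ∷ as) x = R.trans
  (R.+-congˡ (R.*-congˡ (newton-scale c as (x - 1ℝ))))
  (solve 4 (λ c a x p → c :* a :+ x :* (c :* p) := c :* (a :+ x :* p)) R.refl c a x _)

horner-scale : ∀ c as y → horner (map (c *_) as) y ≈ c * horner as y
horner-scale c []       y = R.sym (R.zeroʳ c)
horner-scale c (a ∷ as) y = R.trans
  (R.+-congˡ (R.*-congˡ (horner-scale c as y)))
  (solve 4 (λ c a x p → c :* a :+ x :* (c :* p) := c :* (a :+ x :* p)) R.refl c a y _)

newton-cong : ∀ as → x ≈ x′ → newton as x ≈ newton as x′
newton-cong []       eq = R.refl
newton-cong (a ∷ as) eq =
  R.+-congˡ (R.*-cong eq (newton-cong as (R.+-congʳ eq)))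

-- At x = 0 only the leading coefficient survives; once it is known to vanish,
-- x = m + 1 gives the value at m of the remaining Newton series.
newton≈0⇒horner≈0 : ∀ as → (∀ m → newton as (fromℕ′ m) ≈ 0ℝ) → ∀ y → horner as y ≈ 0ℝ
newton≈0⇒horner≈0 []       vanish y = R.refl
newton≈0⇒horner≈0 (a ∷ as) vanish y = begin
  a + y * horner as y  ≈⟨ R.+-cong a≈0 (R.*-congˡ (newton≈0⇒horner≈0 as tail-vanish y)) ⟩
  0ℝ + y * 0ℝ          ≈⟨ R.trans (R.+-identityˡ _) (R.zeroʳ y) ⟩
  0ℝ                   ∎
  where
  a≈0 : a ≈ 0ℝ
  a≈0 = begin
    a                              ≈⟨ R.+-identityʳ a ⟨
    a + 0ℝ                         ≈⟨ R.+-congˡ (R.zeroˡ _) ⟨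
    a + 0ℝ * newton as (0ℝ - 1ℝ)   ≈⟨ vanish 0 ⟩
    0ℝ                             ∎

  pred-suc : ∀ m → fromℕ′ (suc m) - 1ℝ ≈ fromℕ′ m
  pred-suc m = begin
    1ℝ + fromℕ′ m - 1ℝ    ≈⟨ solve 3 (λ a b c → a :+ b :+ c := b :+ (a :+ c)) R.refl 1ℝ _ _ ⟩
    fromℕ′ m + (1ℝ - 1ℝ)  ≈⟨ R.+-congˡ (R.-‿inverseʳ 1ℝ) ⟩
    fromℕ′ m + 0ℝ         ≈⟨ R.+-identityʳ _ ⟩
    fromℕ′ m              ∎

  tail-vanish : ∀ m → newton as (fromℕ′ m) ≈ 0ℝ
  tail-vanish m = fromℕ′-cancel m (begin
    fromℕ′ (suc m) * newton as (fromℕ′ m)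
      ≈⟨ R.*-congˡ (newton-cong as (pred-suc m)) ⟨
    fromℕ′ (suc m) * newton as (fromℕ′ (suc m) - 1ℝ)
      ≈⟨ R.trans (R.+-congʳ a≈0) (R.+-identityˡ _) ⟨
    newton (a ∷ as) (fromℕ′ (suc m))
      ≈⟨ vanish (suc m) ⟩
    0ℝ ∎)

-- The umbral functional.

-- v = L f, where L is the linear functional (x)ₖ ↦ yᵏ on polynomial functions.
record Umbral (y : ℝ) (φ : ℝ → ℝ) (v : ℝ) : Set where
  constructor umbral
  field
    coefficients : List ℝ
    represents   : ∀ x → φ x ≈ newton coefficients x
    evaluates    : v ≈ horner coefficients y

umbral-cong : (∀ x → φ x ≈ ψ x) → u ≈ v → Umbral y φ u → Umbral y ψ v
umbral-cong φ≈ψ u≈v (umbral as φ≈as u≈as) =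
  umbral as (λ x → R.trans (R.sym (φ≈ψ x)) (φ≈as x)) (R.trans (R.sym u≈v) u≈as)

umbral-+ : Umbral y φ u → Umbral y ψ v → Umbral y (λ x → φ x + ψ x) (u + v)
umbral-+ {y} (umbral as φ≈as u≈as) (umbral bs ψ≈bs v≈bs) = umbral (as ⊕ bs)
  (λ x → R.trans (R.+-cong (φ≈as x) (ψ≈bs x)) (R.sym (newton-⊕ as bs x)))
  (R.trans (R.+-cong u≈as v≈bs) (R.sym (horner-⊕ as bs y)))

umbral-scale : ∀ c → Umbral y φ v → Umbral y (λ x → c * φ x) (c * v)
umbral-scale {y} c (umbral as φ≈as v≈as) = umbral (map (c *_) as)
  (λ x → R.trans (R.*-congˡ (φ≈as x)) (R.sym (newton-scale c as x)))
  (R.trans (R.*-congˡ v≈as) (R.sym (horner-scale c as y)))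

-- Prepending a zero coefficient moves every (x)ₖ to (x)ₖ₊₁ and every yᵏ to yᵏ⁺¹; in nested form
-- both are immediate.
umbral-shift : Umbral y φ v → Umbral y (λ x → x * φ (x - 1ℝ)) (y * v)
umbral-shift (umbral as φ≈as v≈as) = umbral (0ℝ ∷ as)
  (λ x → R.trans (R.*-congˡ (φ≈as (x - 1ℝ))) (R.sym (R.+-identityˡ _)))
  (R.trans (R.*-congˡ v≈as) (R.sym (R.+-identityˡ _)))

umbral-sum : ∀ {n} {φ : Fin n → ℝ → ℝ} {v : Fin n → ℝ} →
             (∀ i → Umbral y (φ i) (v i)) → Umbral y (λ x → sum (λ i → φ i x)) (sum v)
umbral-sum {n = zero}  h = umbral [] (λ _ → R.refl) R.refl
umbral-sum {n = suc n} h = umbral-+ (h Fin.zero) (umbral-sum (h ∘ Fin.suc))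

umbral-zero : (∀ x → φ x ≈ 0ℝ) → Umbral y φ v → v ≈ 0ℝ
umbral-zero {y = y} φ≈0 (umbral as φ≈as v≈as) = R.trans v≈as
  (newton≈0⇒horner≈0 as
    (λ m → R.trans (R.sym (φ≈as (fromℕ′ m))) (φ≈0 (fromℕ′ m))) y)

-- Well-definedness of the functional: by linearity `u + - 1ℝ * v` is a value at the zero function.
-- This turns identities between functions of x into identities between Bell polynomials in y.
umbral-unique : Umbral y φ u → Umbral y φ v → u ≈ v
umbral-unique U V = RP.x∙y⁻¹≈ε⇒x≈y _ _
  (R.trans (R.+-congˡ (R.sym (RP.-1*x≈-x _)))
    (umbral-zero (λ x → R.trans (R.+-congˡ (RP.-1*x≈-x _)) (R.-‿inverseʳ _))
      (umbral-+ U (umbral-scale (- 1ℝ) V))))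

-- Bell polynomials as umbral values.

-- `falling` grows at its last factor, whereas `newton` peels off the first. The induction rests on
-- x - (1 + k) = (x - 1) - k.
falling-suc : ∀ x k → falling x (suc k) ≈ x * falling (x - 1ℝ) k
falling-suc x zero = begin
  1ℝ * (x - 0ℝ)  ≈⟨ R.*-identityˡ _ ⟩
  x - 0ℝ         ≈⟨ R.+-congˡ RP.-0#≈0# ⟩
  x + 0ℝ         ≈⟨ R.+-identityʳ x ⟩
  x              ≈⟨ R.*-identityʳ x ⟨
  x * 1ℝ         ∎
falling-suc x (suc k) = begin
  falling x (suc k) * (x - (1ℝ + fromℕ′ k))
    ≈⟨ R.*-cong (falling-suc x k) (R.+-congˡ (R.sym (RP.-‿+-comm 1ℝ (fromℕ′ k)))) ⟩
  x * falling (x - 1ℝ) k * (x + (- 1ℝ - fromℕ′ k))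
    ≈⟨ solve 4 (λ x f a b → x :* f :* (x :+ (a :+ b)) := x :* (f :* (x :+ a :+ b)))
         R.refl x _ _ _ ⟩
  x * (falling (x - 1ℝ) k * (x - 1ℝ - fromℕ′ k)) ∎

*-swap : ∀ x y u → x * (y * u) ≈ y * (x * u)
*-swap = solve 3 (λ x y u → x :* (y :* u) := y :* (x :* u)) R.refl

newton-tabulate : ∀ {n} (a : Fin n → ℝ) x →
                  newton (tabulate a) x ≈ sum (λ k → a k * falling x (toℕ k))
newton-tabulate {zero}  a x = R.refl
newton-tabulate {suc n} a x = R.+-cong (R.sym (R.*-identityʳ _)) (begin
  x * newton (tabulate (a ∘ Fin.suc)) (x - 1ℝ)
    ≈⟨ R.*-congˡ (newton-tabulate (a ∘ Fin.suc) (x - 1ℝ)) ⟩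
  x * sum (λ k → a (Fin.suc k) * falling (x - 1ℝ) (toℕ k))
    ≈⟨ *-distribˡ-sum x (λ k → a (Fin.suc k) * falling (x - 1ℝ) (toℕ k)) ⟩
  sum (λ k → x * (a (Fin.suc k) * falling (x - 1ℝ) (toℕ k)))
    ≈⟨ sum-cong-≋ {n} (λ k → R.trans
         (*-swap x (a (Fin.suc k)) (falling (x - 1ℝ) (toℕ k)))
         (R.*-congˡ {a (Fin.suc k)} (R.sym (falling-suc x (toℕ k))))) ⟩
  sum (λ k → a (Fin.suc k) * falling x (suc (toℕ k))) ∎)

horner-tabulate : ∀ {n} (a : Fin n → ℝ) y →
                  horner (tabulate a) y ≈ sum (λ k → a k * y ^ toℕ k)
horner-tabulate {zero}  a y = R.refl
horner-tabulate {suc n} a y = R.+-cong (R.sym (R.*-identityʳ _)) (begin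
  y * horner (tabulate (a ∘ Fin.suc)) y
    ≈⟨ R.*-congˡ (horner-tabulate (a ∘ Fin.suc) y) ⟩
  y * sum (λ k → a (Fin.suc k) * y ^ toℕ k)
    ≈⟨ *-distribˡ-sum y (λ k → a (Fin.suc k) * y ^ toℕ k) ⟩
  sum (λ k → y * (a (Fin.suc k) * y ^ toℕ k))
    ≈⟨ sum-cong-≋ {n} (λ k → *-swap y (a (Fin.suc k)) (y ^ toℕ k)) ⟩
  sum (λ k → a (Fin.suc k) * y ^ suc (toℕ k)) ∎)

-- The defining expansion of the Stirling numbers is already a Newton series, and replacing (x)ₖ by
-- yᵏ in it is the definition of the Bell polynomial.
bell-umbral : ∀ r S → IsDegenerateStirling lam r S → ∀ n y →
  Umbral y (λ x → degenerateFalling lam (x + fromℕ′ r) n) (bellPolynomial S n y)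
bell-umbral r S isS n y = umbral (tabulate {n = suc n} (λ k → S n (toℕ k)))
  (λ x → R.trans (isS n x) (R.sym (newton-tabulate {suc n} (λ k → S n (toℕ k)) x)))
  (R.sym (horner-tabulate {suc n} (λ k → S n (toℕ k)) y))

-- Degenerate falling factorials.

degenerateFalling-cong : ∀ n → x ≈ x′ → degenerateFalling lam x n ≈ degenerateFalling lam x′ n
degenerateFalling-cong zero    eq = R.refl
degenerateFalling-cong (suc n) eq = R.*-cong (degenerateFalling-cong n eq) (R.+-congʳ eq)

fromℕ′-suc-* : ∀ n y → fromℕ′ (suc n) * y ≈ y + fromℕ′ n * y
fromℕ′-suc-* n y = R.trans (R.distribʳ y 1ℝ (fromℕ′ n)) (R.+-congʳ (R.*-identityˡ y))

degenerateFalling-suc : ∀ lam c n →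
  degenerateFalling lam c (suc n) ≈ c * degenerateFalling lam (c - lam) n
degenerateFalling-suc lam c zero = begin
  1ℝ * (c - 0ℝ * lam)  ≈⟨ R.*-identityˡ _ ⟩
  c - 0ℝ * lam         ≈⟨ R.+-congˡ (R.trans (R.-‿cong (R.zeroˡ lam)) RP.-0#≈0#) ⟩
  c + 0ℝ               ≈⟨ R.+-identityʳ c ⟩
  c                    ≈⟨ R.*-identityʳ c ⟨
  c * 1ℝ               ∎
degenerateFalling-suc lam c (suc n) = begin
  degenerateFalling lam c (suc n) * (c - fromℕ′ (suc n) * lam)
    ≈⟨ R.*-cong (degenerateFalling-suc lam c n)
         (R.+-congˡ (R.trans (R.-‿cong (fromℕ′-suc-* n lam)) (R.sym (RP.-‿+-comm _ _)))) ⟩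
  c * degenerateFalling lam (c - lam) n * (c + (- lam - fromℕ′ n * lam))
    ≈⟨ solve 4 (λ x f a b → x :* f :* (x :+ (a :+ b)) := x :* (f :* (x :+ a :+ b)))
         R.refl c _ _ _ ⟩
  c * (degenerateFalling lam (c - lam) n * (c - lam - fromℕ′ n * lam)) ∎

-- Each factor -λ - jλ is (j + 1)(-λ). This accounts for the power and the factorial in the first
-- sum of the theorem.
degenerateFalling-neg : ∀ lam n →
  degenerateFalling lam (- lam) n ≈ (- lam) ^ n * fromℕ′ (n !)
degenerateFalling-neg lam zero    = R.sym (R.trans (R.*-identityˡ _) (R.+-identityʳ 1ℝ))
degenerateFalling-neg lam (suc n) = begin
  degenerateFalling lam (- lam) n * (- lam - fromℕ′ n * lam)
    ≈⟨ R.*-cong (degenerateFalling-neg lam n) (R.+-congˡ (RP.-‿distribʳ-* (fromℕ′ n) lam)) ⟩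
  (- lam) ^ n * fromℕ′ (n !) * (- lam + fromℕ′ n * - lam)
    ≈⟨ R.*-congˡ (R.sym (fromℕ′-suc-* n (- lam))) ⟩
  (- lam) ^ n * fromℕ′ (n !) * (fromℕ′ (suc n) * - lam)
    ≈⟨ solve 4 (λ p f s l → p :* f :* (s :* l) := l :* p :* (s :* f))
         R.refl ((- lam) ^ n) _ _ _ ⟩
  - lam * (- lam) ^ n * (fromℕ′ (suc n) * fromℕ′ (n !))
    ≈⟨ R.*-congˡ (R.sym (fromℕ′-* (suc n) (n !))) ⟩
  - lam * (- lam) ^ n * fromℕ′ (suc n !) ∎

-- Pascal's rule under a sum and the degenerate Vandermonde identity.

∑-last : ∀ (g : ℕ → ℝ) n → ∑[ k ≤ suc n ] g (toℕ k) ≈ ∑[ k ≤ n ] g (toℕ k) + g (suc n)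
∑-last g n = R.trans (sum-init-last {suc n} (λ k → g (toℕ k)))
  (R.+-cong
    (sum-cong-≋ {suc n} (λ k → R.reflexive (≡.cong g (toℕ-inject₁ k))))
    (R.reflexive (≡.cong g (toℕ-fromℕ (suc n)))))

-- Pascal's rule splits the terms with k ≥ 1 in two; one half is already indexed by k ≤ n, the other
-- is completed by the term at 0 and loses its vanishing top term.
∑-pascal : ∀ (h : ℕ → ℕ → ℝ) n →
  ∑[ k ≤ suc n ] (fromℕ′ (suc n C toℕ k) * h (toℕ k) (suc n ∸ toℕ k))
    ≈ ∑[ k ≤ n ] (fromℕ′ (n C toℕ k)
        * (h (suc (toℕ k)) (n ∸ toℕ k) + h (toℕ k) (suc (n ∸ toℕ k))))
∑-pascal h n = begin
  -- The leading term is `g 0` by computation: `suc n C 0` and `n C 0` both reduce to 1.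
  g 0 + ∑[ k ≤ n ] (fromℕ′ (suc n C suc (toℕ k)) * h (suc (toℕ k)) (n ∸ toℕ k))
    ≈⟨ R.+-congˡ (sum-cong-≋ {suc n} (λ k → split (toℕ k))) ⟩
  g 0 + ∑[ k ≤ n ] (p (toℕ k) + g (suc (toℕ k)))
    ≈⟨ R.+-congˡ (∑-distrib-+ {suc n} (λ k → p (toℕ k)) (λ k → g (suc (toℕ k)))) ⟩
  g 0 + (∑[ k ≤ n ] p (toℕ k) + ∑[ k ≤ n ] g (suc (toℕ k)))
    ≈⟨ solve 3 (λ a b c → a :+ (b :+ c) := b :+ (a :+ c)) R.refl _ _ _ ⟩
  ∑[ k ≤ n ] p (toℕ k) + ∑[ k ≤ suc n ] g (toℕ k)
    ≈⟨ R.+-congˡ (R.trans (∑-last g n) (R.trans (R.+-congˡ g-top) (R.+-identityʳ _))) ⟩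
  ∑[ k ≤ n ] p (toℕ k) + ∑[ k ≤ n ] g (toℕ k)
    ≈⟨ ∑-distrib-+ {suc n} (λ k → p (toℕ k)) (λ k → g (toℕ k)) ⟨
  ∑[ k ≤ n ] (p (toℕ k) + g (toℕ k))
    ≈⟨ sum-cong-≋ {suc n} (λ k → merge (toℕ k) (toℕ≤pred[n] k)) ⟩
  ∑[ k ≤ n ] (fromℕ′ (n C toℕ k)
        * (h (suc (toℕ k)) (n ∸ toℕ k) + h (toℕ k) (suc (n ∸ toℕ k)))) ∎
  where
  p g : ℕ → ℝ
  p k = fromℕ′ (n C k) * h (suc k) (n ∸ k)
  g k = fromℕ′ (n C k) * h k (suc n ∸ k)

  split : ∀ k → fromℕ′ (suc n C suc k) * h (suc k) (n ∸ k) ≈ p k + g (suc k)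
  split k = R.trans
    (R.*-congʳ (R.trans
      (R.reflexive (≡.cong fromℕ′ (≡.sym (nCk+nC[k+1]≡[n+1]C[k+1] n k))))
      (fromℕ′-+ (n C k) (n C suc k))))
    (R.distribʳ _ _ _)

  -- The bound is what makes the truncated difference `suc n ∸ k` equal to `suc (n ∸ k)`.
  merge : ∀ k → k ℕ.≤ n → p k + g k ≈ fromℕ′ (n C k) * (h (suc k) (n ∸ k) + h k (suc (n ∸ k)))
  merge k k≤n = R.trans
    (R.+-congˡ (R.*-congˡ (R.reflexive (≡.cong (h k) (ℕ.+-∸-assoc 1 k≤n)))))
    (R.sym (R.distribˡ _ _ _))

  g-top : g (suc n) ≈ 0ℝ
  g-top = R.trans
    (R.*-congʳ (R.reflexive (≡.cong fromℕ′ (k>n⇒nCk≡0 (ℕ.n<1+n n)))))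
    (R.zeroˡ _)

-- By induction: in the k-th term the new factor a + b - nλ splits as (a - kλ) + (b - (n - k)λ), and
-- each part extends one of the two products. `∑-pascal` recombines the result.
vandermonde : ∀ lam a b n →
  degenerateFalling lam (a + b) n
    ≈ ∑[ k ≤ n ] (fromℕ′ (n C toℕ k)
        * (degenerateFalling lam a (toℕ k) * degenerateFalling lam b (n ∸ toℕ k)))
vandermonde lam a b zero = R.sym (begin
  -- `fromℕ′ (0 C 0)` computes to `1ℝ + 0ℝ`, and the final `0ℝ` is the empty rest of the sum.
  (1ℝ + 0ℝ) * (1ℝ * 1ℝ) + 0ℝ  ≈⟨ R.+-identityʳ _ ⟩
  (1ℝ + 0ℝ) * (1ℝ * 1ℝ)       ≈⟨ R.*-cong (R.+-identityʳ 1ℝ) (R.*-identityˡ 1ℝ) ⟩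
  1ℝ * 1ℝ                     ≈⟨ R.*-identityˡ 1ℝ ⟩
  1ℝ                          ∎)
vandermonde lam a b (suc n) = begin
  degenerateFalling lam (a + b) n * (a + b - fromℕ′ n * lam)
    ≈⟨ R.*-congʳ (vandermonde lam a b n) ⟩
  (∑[ k ≤ n ] (fromℕ′ (n C toℕ k) * (A (toℕ k) * B (n ∸ toℕ k)))) * (a + b - fromℕ′ n * lam)
    ≈⟨ *-distribʳ-sum {suc n} (a + b - fromℕ′ n * lam)
         (λ k → fromℕ′ (n C toℕ k) * (A (toℕ k) * B (n ∸ toℕ k))) ⟩
  ∑[ k ≤ n ] (fromℕ′ (n C toℕ k) * (A (toℕ k) * B (n ∸ toℕ k)) * (a + b - fromℕ′ n * lam))
    ≈⟨ sum-cong-≋ {suc n} (λ k → step (toℕ k) (toℕ≤pred[n] k)) ⟩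
  ∑[ k ≤ n ] (fromℕ′ (n C toℕ k)
    * (A (suc (toℕ k)) * B (n ∸ toℕ k) + A (toℕ k) * B (suc (n ∸ toℕ k))))
    ≈⟨ ∑-pascal (λ i j → A i * B j) n ⟨
  ∑[ k ≤ suc n ] (fromℕ′ (suc n C toℕ k) * (A (toℕ k) * B (suc n ∸ toℕ k))) ∎
  where
  A B : ℕ → ℝ
  A = degenerateFalling lam a
  B = degenerateFalling lam b

  -n*lam : ∀ k → k ℕ.≤ n → - (fromℕ′ n * lam) ≈ - (fromℕ′ k * lam) - fromℕ′ (n ∸ k) * lam
  -n*lam k k≤n = begin
    - (fromℕ′ n * lam)
      ≈⟨ R.-‿cong (R.*-congʳ (R.reflexive (≡.cong fromℕ′ (≡.sym (ℕ.m+[n∸m]≡n k≤n))))) ⟩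
    - (fromℕ′ (k ℕ.+ (n ∸ k)) * lam)
      ≈⟨ R.-‿cong (R.trans (R.*-congʳ (fromℕ′-+ k (n ∸ k))) (R.distribʳ lam _ _)) ⟩
    - (fromℕ′ k * lam + fromℕ′ (n ∸ k) * lam)
      ≈⟨ RP.-‿+-comm _ _ ⟨
    - (fromℕ′ k * lam) - fromℕ′ (n ∸ k) * lam ∎

  step : ∀ k → k ℕ.≤ n →
    fromℕ′ (n C k) * (A k * B (n ∸ k)) * (a + b - fromℕ′ n * lam)
      ≈ fromℕ′ (n C k) * (A (suc k) * B (n ∸ k) + A k * B (suc (n ∸ k)))
  step k k≤n = R.trans (R.*-congˡ (R.+-congˡ (-n*lam k k≤n)))
    (solve 7 (λ c p q a b u v → c :* (p :* q) :* (a :+ b :+ (u :+ v))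
        := c :* (p :* (a :+ u) :* q :+ p :* (q :* (b :+ v))))
      R.refl (fromℕ′ (n C k)) (A k) (B (n ∸ k)) a b
        (- (fromℕ′ k * lam)) (- (fromℕ′ (n ∸ k) * lam)))

-- The two recurrences, for an arbitrary real y in place of |z|².

module _ (lam : ℝ) (S : ℕ → ℕ → ℕ → ℝ) (isS : ∀ r → IsDegenerateStirling lam r (S r))
         (r n : ℕ) (y : ℝ) where

  private
    D : ℝ → ℕ → ℝ
    D = degenerateFalling lam
    ρ : ℝ
    ρ = fromℕ′ r

    c : ℕ → ℝ
    c k = fromℕ′ (n C k) * (- lam) ^ (n ∸ k) * fromℕ′ ((n ∸ k) !)

    c≈ : ∀ k → c k ≈ fromℕ′ (n C k) * D (- lam) (n ∸ k)
    c≈ k = R.trans (R.*-assoc _ _ _) (R.*-congˡ (R.sym (degenerateFalling-neg lam (n ∸ k))))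

    -- Raising r by one compensates the lowered argument that `umbral-shift` requires; this is the
    -- source of the order r + 1 in the first sum.
    -1+suc : ∀ x → (x - 1ℝ) + fromℕ′ (suc r) ≈ x + ρ
    -1+suc x = begin
      x - 1ℝ + (1ℝ + ρ)
        ≈⟨ solve 4 (λ x a b c → x :+ a :+ (b :+ c) := x :+ c :+ (a :+ b)) R.refl x _ _ _ ⟩
      x + ρ + (- 1ℝ + 1ℝ)  ≈⟨ R.+-congˡ (R.-‿inverseˡ 1ℝ) ⟩
      x + ρ + 0ℝ           ≈⟨ R.+-identityʳ _ ⟩
      x + ρ                ∎

    -- Here the lowering of x is compensated by passing from -λ to 1 - λ, so the order stays r.
    -1+1-lam : ∀ x → (1ℝ - lam) + ((x - 1ℝ) + ρ) ≈ (x + ρ) - lam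
    -1+1-lam x = begin
      1ℝ - lam + (x - 1ℝ + ρ)
        ≈⟨ solve 5 (λ o l x m r → o :+ l :+ (x :+ m :+ r) := x :+ r :+ l :+ (m :+ o))
             R.refl 1ℝ (- lam) x (- 1ℝ) ρ ⟩
      x + ρ - lam + (- 1ℝ + 1ℝ)  ≈⟨ R.+-congˡ (R.-‿inverseˡ 1ℝ) ⟩
      x + ρ - lam + 0ℝ           ≈⟨ R.+-identityʳ _ ⟩
      x + ρ - lam                ∎

  bellPolynomial-suc :
    bellPolynomial (S r) (suc n) y
      ≈ ∑[ k ≤ n ] (fromℕ′ (n C toℕ k) * (- lam) ^ (n ∸ toℕ k) * fromℕ′ ((n ∸ toℕ k) !)
          * (y * bellPolynomial (S (suc r)) (toℕ k) y + ρ * bellPolynomial (S r) (toℕ k) y))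
  bellPolynomial-suc = umbral-unique (bell-umbral r (S r) (isS r) (suc n) y)
    (umbral-cong (λ x → R.sym (expand x)) R.refl
      (umbral-sum {n = suc n} λ k → umbral-scale (c (toℕ k))
        (umbral-+ (umbral-shift (bell-umbral (suc r) (S (suc r)) (isS (suc r)) (toℕ k) y))
                  (umbral-scale ρ (bell-umbral r (S r) (isS r) (toℕ k) y)))))
    where
    -- The argument after the factor `x` is written through `x - 1ℝ` so that the term has the shape
    -- produced by `umbral-shift`.
    expand : ∀ x → D (x + ρ) (suc n)
      ≈ ∑[ k ≤ n ] (c (toℕ k) * (x * D ((x - 1ℝ) + fromℕ′ (suc r)) (toℕ k)
                                   + ρ * D (x + ρ) (toℕ k)))
    expand x = begin
      D (x + ρ) (suc n)
        ≈⟨ degenerateFalling-suc lam (x + ρ) n ⟩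
      (x + ρ) * D (x + ρ - lam) n
        ≈⟨ R.*-congˡ (vandermonde lam (x + ρ) (- lam) n) ⟩
      (x + ρ) * ∑[ k ≤ n ] t (toℕ k)
        ≈⟨ *-distribˡ-sum {suc n} (x + ρ) (λ k → t (toℕ k)) ⟩
      ∑[ k ≤ n ] ((x + ρ) * t (toℕ k))
        ≈⟨ sum-cong-≋ {suc n} (λ k → step (toℕ k)) ⟩
      ∑[ k ≤ n ] (c (toℕ k) * (x * D ((x - 1ℝ) + fromℕ′ (suc r)) (toℕ k)
                                   + ρ * D (x + ρ) (toℕ k))) ∎
      where
      t : ℕ → ℝ
      t k = fromℕ′ (n C k) * (D (x + ρ) k * D (- lam) (n ∸ k))
      step : ∀ k → (x + ρ) * t k
        ≈ c k * (x * D ((x - 1ℝ) + fromℕ′ (suc r)) k + ρ * D (x + ρ) k)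
      step k = begin
        (x + ρ) * t k
          ≈⟨ solve 5 (λ x r b d l → (x :+ r) :* (b :* (d :* l)) := b :* l :* (x :* d :+ r :* d))
               R.refl x ρ _ _ _ ⟩
        fromℕ′ (n C k) * D (- lam) (n ∸ k) * (x * D (x + ρ) k + ρ * D (x + ρ) k)
          ≈⟨ R.*-cong (c≈ k) (R.+-congʳ (R.*-congˡ (degenerateFalling-cong k (-1+suc x)))) ⟨
        c k * (x * D ((x - 1ℝ) + fromℕ′ (suc r)) k + ρ * D (x + ρ) k) ∎

  -- Vandermonde is applied twice, with different splittings: -λ against x + r after the factor r,
  -- and 1 - λ against (x - 1) + r after the factor x. The factors (-λ)ₖ,λ and (1 - λ)ₖ,λ are
  -- constant in x, so they pass through the functional as scalars and leave a Bell polynomial of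
  -- index n - k.
  bellPolynomial-suc′ :
    bellPolynomial (S r) (suc n) y
      ≈ ∑[ k ≤ n ] (fromℕ′ (n C toℕ k)
          * (ρ * degenerateFalling lam (- lam) (toℕ k)
             + y * degenerateFalling lam (1ℝ - lam) (toℕ k))
          * bellPolynomial (S r) (n ∸ toℕ k) y)
  bellPolynomial-suc′ = umbral-unique (bell-umbral r (S r) (isS r) (suc n) y)
    (umbral-cong (λ x → R.sym (expand x))
      -- Linearity and the shift yield r(bpφ) + y(bqφ) for each k; this is collected into b(rp +
      -- yq)φ.
      (sum-cong-≋ {suc n} λ k →
        solve 6 (λ b r p y q f →
            r :* (b :* p :* f) :+ y :* (b :* q :* f) := b :* (r :* p :+ y :* q) :* f)
          R.refl (fromℕ′ (n C toℕ k)) ρ (D (- lam) (toℕ k)) y (D (1ℝ - lam) (toℕ k))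
          (bellPolynomial (S r) (n ∸ toℕ k) y))
      (umbral-sum {n = suc n} λ k →
        let B = bell-umbral r (S r) (isS r) (n ∸ toℕ k) y in
        umbral-+ (umbral-scale ρ (umbral-scale (fromℕ′ (n C toℕ k) * D (- lam) (toℕ k)) B))
                 (umbral-shift (umbral-scale (fromℕ′ (n C toℕ k) * D (1ℝ - lam) (toℕ k)) B))))
    where
    term : ℝ → ℝ → ℕ → ℝ
    term b x k = fromℕ′ (n C k) * D b k * D (x + ρ) (n ∸ k)

    expand-shift : ∀ a b x → b + (x + ρ) ≈ a → D a n ≈ ∑[ k ≤ n ] term b x (toℕ k)
    expand-shift a b x eq = begin
      D a n                       ≈⟨ degenerateFalling-cong n eq ⟨
      D (b + (x + ρ)) n           ≈⟨ vandermonde lam b (x + ρ) n ⟩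
      ∑[ k ≤ n ] (fromℕ′ (n C toℕ k) * (D b (toℕ k) * D (x + ρ) (n ∸ toℕ k)))
        ≈⟨ sum-cong-≋ {suc n} (λ k → R.*-assoc
             (fromℕ′ (n C toℕ k)) (D b (toℕ k)) (D (x + ρ) (n ∸ toℕ k))) ⟨
      ∑[ k ≤ n ] term b x (toℕ k) ∎

    expand : ∀ x → D (x + ρ) (suc n)
      ≈ ∑[ k ≤ n ] (ρ * term (- lam) x (toℕ k) + x * term (1ℝ - lam) (x - 1ℝ) (toℕ k))
    expand x = begin
      D (x + ρ) (suc n)
        ≈⟨ degenerateFalling-suc lam (x + ρ) n ⟩
      (x + ρ) * D (x + ρ - lam) n
        ≈⟨ R.trans (R.distribʳ _ x ρ) (R.+-comm _ _) ⟩
      ρ * D (x + ρ - lam) n + x * D (x + ρ - lam) n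
        ≈⟨ R.+-cong (R.*-congˡ (expand-shift _ (- lam) x (R.+-comm _ _)))
                    (R.*-congˡ (expand-shift _ (1ℝ - lam) (x - 1ℝ) (-1+1-lam x))) ⟩
      ρ * ∑[ k ≤ n ] term (- lam) x (toℕ k) + x * ∑[ k ≤ n ] term (1ℝ - lam) (x - 1ℝ) (toℕ k)
        ≈⟨ R.+-cong (*-distribˡ-sum {suc n} ρ (λ k → term (- lam) x (toℕ k)))
                    (*-distribˡ-sum {suc n} x (λ k → term (1ℝ - lam) (x - 1ℝ) (toℕ k))) ⟩
      ∑[ k ≤ n ] (ρ * term (- lam) x (toℕ k)) + ∑[ k ≤ n ] (x * term (1ℝ - lam) (x - 1ℝ) (toℕ k))
        ≈⟨ ∑-distrib-+ {suc n} (λ k → ρ * term (- lam) x (toℕ k))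
                               (λ k → x * term (1ℝ - lam) (x - 1ℝ) (toℕ k)) ⟨
      ∑[ k ≤ n ] (ρ * term (- lam) x (toℕ k) + x * term (1ℝ - lam) (x - 1ℝ) (toℕ k)) ∎

theorem9 : (lam : ℝ) (S : ℕ → ℕ → ℕ → ℝ) →
  (∀ r → IsDegenerateStirling lam r (S r)) →
  ∀ (r n : ℕ) →
  (∀ (z : ℂ) →
    (bellPolynomial (S r) (suc n) ∣ z ∣²
      ≈ ∑[ k ≤ n ] (fromℕ′ (n C toℕ k) * (- lam) ^ (n ∸ toℕ k) * fromℕ′ ((n ∸ toℕ k) !)
          * (∣ z ∣² * bellPolynomial (S (suc r)) (toℕ k) ∣ z ∣²
             + fromℕ′ r * bellPolynomial (S r) (toℕ k) ∣ z ∣²)))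
    ×
    (∑[ k ≤ n ] (fromℕ′ (n C toℕ k) * (- lam) ^ (n ∸ toℕ k) * fromℕ′ ((n ∸ toℕ k) !)
          * (∣ z ∣² * bellPolynomial (S (suc r)) (toℕ k) ∣ z ∣²
             + fromℕ′ r * bellPolynomial (S r) (toℕ k) ∣ z ∣²))
      ≈ ∑[ k ≤ n ] (fromℕ′ (n C toℕ k)
          * (fromℕ′ r * degenerateFalling lam (- lam) (toℕ k)
             + ∣ z ∣² * degenerateFalling lam (1ℝ - lam) (toℕ k))
          * bellPolynomial (S r) (n ∸ toℕ k) ∣ z ∣²)))
  ×
  ((bellNumber (S r) (suc n)
      ≈ ∑[ k ≤ n ] (fromℕ′ (n C toℕ k) * (- lam) ^ (n ∸ toℕ k) * fromℕ′ ((n ∸ toℕ k) !)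
          * (bellNumber (S (suc r)) (toℕ k) + fromℕ′ r * bellNumber (S r) (toℕ k))))
    ×
    (∑[ k ≤ n ] (fromℕ′ (n C toℕ k) * (- lam) ^ (n ∸ toℕ k) * fromℕ′ ((n ∸ toℕ k) !)
          * (bellNumber (S (suc r)) (toℕ k) + fromℕ′ r * bellNumber (S r) (toℕ k)))
      ≈ ∑[ k ≤ n ] (fromℕ′ (n C toℕ k)
          * (fromℕ′ r * degenerateFalling lam (- lam) (toℕ k)
             + degenerateFalling lam (1ℝ - lam) (toℕ k))
          * bellNumber (S r) (n ∸ toℕ k))))
theorem9 lam S isS r n =
    -- The two sums are equal because each equals the left-hand Bell polynomial.
    (λ z → first ∣ z ∣² , R.trans (R.sym (first ∣ z ∣²)) (second ∣ z ∣²))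
  , first₁ , R.trans (R.sym first₁) second₁
  where
  first  = bellPolynomial-suc lam S isS r n
  second = bellPolynomial-suc′ lam S isS r n
  -- The recurrences hold for every real y, so y = 1 is taken directly; only the factor `1ℝ`
  -- standing for |z|² remains to be removed.
  first₁ = R.trans (first 1ℝ) (sum-cong-≋ {suc n} λ k →
    R.*-congˡ {fromℕ′ (n C toℕ k) * (- lam) ^ (n ∸ toℕ k) * fromℕ′ ((n ∸ toℕ k) !)}
      (R.+-congʳ {fromℕ′ r * bellNumber (S r) (toℕ k)}
        (R.*-identityˡ (bellNumber (S (suc r)) (toℕ k)))))
  second₁ = R.trans (second 1ℝ) (sum-cong-≋ {suc n} λ k →
    R.*-congʳ {bellNumber (S r) (n ∸ toℕ k)} (R.*-congˡ {fromℕ′ (n C toℕ k)}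
      (R.+-congˡ {fromℕ′ r * degenerateFalling lam (- lam) (toℕ k)}
        (R.*-identityˡ (degenerateFalling lam (1ℝ - lam) (toℕ k))))))
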